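{- Given an unweighted directed graph $G$ with $n$ vertices and maximum out-degree $\Delta^+$ that has a directed spanning tree (DST) rooted in a given vertex $r$, such a DST can be enumerated with delay in $O(\Delta^+)$, without preprocessing, with $\Theta(n)$ lazy-initialized memory and space complexity in $\Theta(n)$.
   Context: Graphs $G=(V,E)$ have vertex set $V=\{1,\dots,n\}$ and $m=|E|$ edges. An out-branching of a directed graph $G$ is an acyclic subgraph $B=(V,E')$ with $E'\subseteq E$ in which each vertex has in-degree at most $1$. A directed spanning tree (DST) is a weakly connected out-branching; it has $n-1$ edges and exactly one vertex $r$ of in-degree $0$, its root. Model: word RAM with word size in $\Omega(\log n)$, so that a reference to a vertex or edge fits in a constant number of cells that can be read and written in constant time. The graph is given by (out-)adjacency lists whose lengths can be queried in constant time. Lazy-initialized memory is a block of memory that can be reserved (as if initialized with default values) within constant time, regardless of its size. Space complexity counts the working memory used in addition to the input. Enumeration: given the whole input (including $r$), an enumeration algorithm must, for some single DST $T$ of the graph rooted in $r$, emit each edge of $T$ exactly once. Its delay is the maximum time the algorithm needs to emit the respective next edge; preprocessing time is additional time spent before emitting the first edge. "Without preprocessing" means that the first edge is also emitted within the delay bound. -}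

module Defs where

open import Data.Bool.Base using (if_then_else_; _∧_)
open import Data.Fin.Base using (Fin; toℕ; fromℕ<)
open import Data.List.Base using (List; []; _∷_; map; length; head; drop; allFin)
open import Data.List.Extrema.Nat using (max)
open import Data.List.Membership.Propositional using (_∈_)
open import Data.List.Relation.Unary.Unique.Propositional using (Unique)
open import Data.Maybe.Base using (fromMaybe; just; nothing)
open import Data.Nat.Base using (ℕ; zero; suc; _+_; _*_; _∸_; _^_; _≤_; _/_; _%_)
open import Data.Nat.Properties using (_≟_; _<?_; _≤?_; m^n≢0)
open import Data.Product.Base using (_×_; _,_)
open import Data.Vec.Base using (Vec; lookup; replicate; _[_]≔_)
open import Function.Bundles using (_⇔_)
open import Level using (0ℓ)
open import Relation.Binary.Construct.Closure.Equivalence using (EqClosure)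
open import Relation.Binary.Construct.Closure.Transitive using (TransClosure)
open import Relation.Binary.Core using (Rel; _⇒_)
open import Relation.Binary.PropositionalEquality.Core using (_≡_)
open import Relation.Nullary.Decidable.Core using (yes; no; does)
open import Relation.Nullary.Negation.Core using (¬_)

-- A directed graph on the vertices 0, …, n − 1, given by out-adjacency lists
-- in arbitrary order.  `Unique` rules out parallel edges; loops are allowed.
record Digraph (n : ℕ) : Set where
  field
    out        : Fin n → List (Fin n)
    out-unique : ∀ v → Unique (out v)

  Edge : Rel (Fin n) 0ℓ
  Edge u v = v ∈ out u

  maxOutDegree : ℕ
  maxOutDegree = max 0 (map (λ v → length (out v)) (allFin n))

open Digraph public

-- A spanning subgraph (V , T) is given by its set of edges T.
record IsOutBranching {n} (G : Digraph n) (T : Rel (Fin n) 0ℓ) : Set where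
  field
    subgraph   : T ⇒ Edge G
    acyclic    : ∀ v → ¬ TransClosure T v v
    inDegree≤1 : ∀ {u u′ v} → T u v → T u′ v → u ≡ u′

record IsDST {n} (G : Digraph n) (r : Fin n) (T : Rel (Fin n) 0ℓ) : Set where
  field
    outBranching    : IsOutBranching G T
    weaklyConnected : ∀ u v → EqClosure T u v
    rootInDegree    : ∀ u → ¬ T u r

ListsOnce : ∀ {n} → List (Fin n × Fin n) → Rel (Fin n) 0ℓ → Set
ListsOnce L T = Unique L × (∀ u v → (u , v) ∈ L ⇔ T u v)

data BinOp : Set where
  add sub mul quo rem : BinOp

-- Instructions of a word RAM with k registers.  Destination registers come
-- first; jump targets are positions in the program.
data Instr (k : ℕ) : Set where
  const     : (d : Fin k) (c : ℕ) → Instr k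
  binop     : BinOp → (d x y : Fin k) → Instr k
  load      : (d addr : Fin k) → Instr k
  store     : (addr x : Fin k) → Instr k
  -- Allocate a block of memory and put its base address in d.  Memory from
  -- `alloc` has arbitrary contents, memory from `allocLazy` reads as 0.
  alloc     : (d size : Fin k) → Instr k
  allocLazy : (d size : Fin k) → Instr k
  jump      : (target : ℕ) → Instr k
  jumpIf<   : (x y : Fin k) (target : ℕ) → Instr k
  jumpIf≡   : (x y : Fin k) (target : ℕ) → Instr k
  -- Read-only access to the input.  A reference to an edge is a pair of words:
  -- a vertex v and a position i in the adjacency list of v.
  order     : (d : Fin k) → Instr k
  root      : (d : Fin k) → Instr k
  outDegree : (d v : Fin k) → Instr k
  neighbour : (d v i : Fin k) → Instr k
  emit      : (u v : Fin k) → Instr k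
  halt      : Instr k

Program : ℕ → Set
Program k = List (Instr k)

record State (k : ℕ) : Set where
  constructor ⟨_,_,_,_,_⟩
  field
    pc        : ℕ
    regs      : Vec ℕ k
    mem       : ℕ → ℕ
    -- The cells allocated so far are 0, …, allocated − 1; no other cell may
    -- be accessed.  Memory is never freed.
    allocated : ℕ
    -- How many of the allocated cells came from allocLazy.
    lazyCells : ℕ

  space : ℕ
  space = k + allocated

open State public

initial : ∀ {k} → (ℕ → ℕ) → State k
initial garbage = ⟨ 0 , replicate _ 0 , garbage , 0 , 0 ⟩

data Outcome (k : ℕ) : Set where
  fault  : Outcome k
  halted : Outcome k
  silent : State k → Outcome k
  output : ℕ × ℕ → State k → Outcome k

-- Execution with word size w on the input (G , r).
module WordRAM (w : ℕ) {n : ℕ} (G : Digraph n) (r : Fin n) where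

  -- Every value written to a register passes through `word`, so registers, and
  -- the cells stored from them, always hold w-bit words.
  word : ℕ → ℕ
  word x = _%_ x (2 ^ w) {{m^n≢0 2 w}}

  ⟦_⟧ : BinOp → ℕ → ℕ → ℕ
  ⟦ add ⟧ x y       = x + y
  ⟦ sub ⟧ x y       = x + (2 ^ w ∸ y)
  ⟦ mul ⟧ x y       = x * y
  ⟦ quo ⟧ x zero    = 0
  ⟦ quo ⟧ x (suc y) = x / suc y
  ⟦ rem ⟧ x zero    = 0
  ⟦ rem ⟧ x (suc y) = x % suc y

  -- Invalid vertices have no neighbours, and invalid positions in an adjacency
  -- list read as 0.
  adjacency : ℕ → List ℕ
  adjacency v with v <? n
  ... | yes v<n = map toℕ (out G (fromℕ< v<n))
  ... | no  _   = []

  neighbourAt : ℕ → ℕ → ℕ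
  neighbourAt v i = fromMaybe 0 (head (drop i (adjacency v)))

  module _ {k : ℕ} where

    execute : Instr k → State k → Outcome k
    execute instr s@(⟨ pc , ρ , μ , a , z ⟩) = go instr
      where
      infix 10 _≔_

      ! : Fin k → ℕ
      ! x = lookup ρ x

      _≔_ : Fin k → ℕ → Vec ℕ k
      d ≔ x = ρ [ d ]≔ word x

      next : Vec ℕ k → Outcome k
      next ρ′ = silent ⟨ suc pc , ρ′ , μ , a , z ⟩

      goto : ℕ → Outcome k
      goto target = silent ⟨ target , ρ , μ , a , z ⟩

      go : Instr k → Outcome k
      go (const d c)       = next (d ≔ c)
      go (binop ∙ d x y)   = next (d ≔ ⟦ ∙ ⟧ (! x) (! y))
      go (load d x)        = if does (! x <? a) then next (d ≔ μ (! x)) else fault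
      go (store x y)       =
        if does (! x <? a)
        then silent ⟨ suc pc , ρ , (λ i → if does (i ≟ ! x) then ! y else μ i) , a , z ⟩
        else fault
      go (alloc d x)       =
        if does (a + ! x ≤? 2 ^ w)
        then silent ⟨ suc pc , d ≔ a , μ , a + ! x , z ⟩
        else fault
      go (allocLazy d x)   =
        if does (a + ! x ≤? 2 ^ w)
        then silent ⟨ suc pc , d ≔ a
                    , (λ i → if does (a ≤? i) ∧ does (i <? a + ! x) then 0 else μ i)
                    , a + ! x , z + ! x ⟩
        else fault
      go (jump t)          = goto t
      go (jumpIf< x y t)   = if does (! x <? ! y) then goto t else goto (suc pc)
      go (jumpIf≡ x y t)   = if does (! x ≟ ! y) then goto t else goto (suc pc)
      go (order d)         = next (d ≔ n)
      go (root d)          = next (d ≔ toℕ r)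
      go (outDegree d x)   = next (d ≔ length (adjacency (! x)))
      go (neighbour d x y) = next (d ≔ neighbourAt (! x) (! y))
      go (emit x y)        = output (! x , ! y) ⟨ suc pc , ρ , μ , a , z ⟩
      go halt              = halted

    step : Program k → State k → Outcome k
    step P s with head (drop (pc s) P)
    ... | just instr = execute instr s
    ... | nothing    = fault

    data Silent (P : Program k) : ℕ → State k → State k → Set where
      done : ∀ {s} → Silent P 0 s s
      more : ∀ {t s s′ s″} → step P s ≡ silent s′ → Silent P t s′ s″ →
             Silent P (suc t) s s″

    -- Run P δ τ s L s′: from s the program emits exactly the edges L, in this
    -- order, and halts in s′.  Each emission, counting from s for the first and
    -- from the previous emission for the others, takes at most δ instructions;
    -- halting after the last one takes at most τ.
    data Run (P : Program k) (δ τ : ℕ) :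
             State k → List (Fin n × Fin n) → State k → Set where
      stop : ∀ {t s s′} →
             Silent P t s s′ → step P s′ ≡ halted → suc t ≤ τ →
             Run P δ τ s [] s′
      next : ∀ {t s s₁ s₂ s′ u v L} →
             Silent P t s s₁ → step P s₁ ≡ output (toℕ u , toℕ v) s₂ → suc t ≤ δ →
             Run P δ τ s₂ L s′ →
             Run P δ τ s ((u , v) ∷ L) s′

-- For a quantity x of a run on an input of order n; a single constant c for
-- all inputs gives x ∈ Θ(n).
Within : (c x n : ℕ) → Set
Within c x n = n ≤ c * x × x ≤ c * n

{-# OPTIONS --safe #-}
module Submission where

-- Breadth-first search, one vertex per emitted edge.  As soon as a vertex is taken from the queue
-- its adjacency list is scanned, in time O(Δ⁺), and the tree edges found are appended to the
-- queue; then the oldest queued edge is emitted and its target is scanned next.  If the queue is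
-- empty at this point, the vertices found so far are closed under edges, hence they are all
-- vertices and every edge of the tree has been emitted.  So exactly one scan separates
-- consecutive emissions, and since Δ⁺ ≥ 1 once there is an edge to emit, constant overheads
-- (including the initialization) are O(Δ⁺) as well.

open import Defs
open import Data.Bool.Base using (if_then_else_; _∧_)
open import Data.Fin.Base using (Fin; zero; suc; toℕ)
open import Data.Fin.Patterns
open import Data.Fin.Properties
  using (_≟_; injective⇒≤; toℕ<n; toℕ-injective; fromℕ<-toℕ)
open import Data.List.Base
  using (List; []; _∷_; _++_; _∷ʳ_; map; length; lookup; allFin; head; drop)
open import Data.List.Extrema.Nat using (xs≤max)
open import Data.List.Membership.DecPropositional using (_∈?_)
open import Data.List.Membership.Propositional using (_∈_; _∉_)
open import Data.List.Membership.Propositional.Properties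
  using (∈-++⁺ˡ; ∈-++⁺ʳ; ∈-++⁻; ∈-map⁺; ∈-lookup; ∈-allFin)
open import Data.List.Properties
  using (map-++; length-map; length-++; ++-assoc; ++-identityʳ; ∷ʳ-++)
open import Data.List.Relation.Unary.All as All using ([])
open import Data.List.Relation.Unary.AllPairs as AllPairs using ([]; _∷_)
open import Data.List.Relation.Unary.Any using (here; there)
open import Data.List.Relation.Unary.Unique.Propositional using (Unique)
import Data.List.Relation.Unary.Unique.Propositional.Properties as Unique
open import Data.Maybe.Base using (fromMaybe)
open import Data.Nat.Base
  using (ℕ; zero; suc; _+_; _*_; _^_; _≤_; _<_; z≤n; s≤s; z<s; ⌊_/2⌋; ⌈_/2⌉)
open import Data.Nat.DivMod using (m<n⇒m%n≡m)
open import Data.Nat.Induction using (<-rec)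
open import Data.Nat.Logarithm using (⌈log₂_⌉; ⌈log₂⌈n/2⌉⌉≡⌈log₂n⌉∸1)
open import Data.Nat.Properties as ℕ hiding (_≟_)
open import Data.Nat.Tactic.RingSolver using (solve-∀)
open import Data.Product.Base using (_×_; _,_; proj₁; proj₂; Σ-syntax; ∃-syntax)
open import Data.Sum.Base using (_⊎_; inj₁; inj₂)
open import Data.Vec.Base using ([]; _∷_; _[_]≔_)
open import Function.Base using (_∘_; _$_; flip)
open import Function.Construct.Identity using (⇔-id)
open import Level using (0ℓ)
open import Relation.Binary.Construct.Closure.Equivalence as Eq using (EqClosure)
open import Relation.Binary.Construct.Closure.ReflexiveTransitive using (Star; ε; _◅_; _◅◅_)
open import Relation.Binary.Construct.Closure.Symmetric using (fwd; bwd)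
open import Relation.Binary.Construct.Closure.Transitive using (TransClosure; [_]; _∷_)
open import Relation.Binary.Core using (Rel)
open import Relation.Binary.PropositionalEquality
  using (_≡_; _≢_; refl; sym; trans; cong; subst; module ≡-Reasoning)
open import Relation.Nullary.Decidable.Core using (Dec; yes; no; does)
open import Relation.Nullary.Negation.Core using (¬_; contradiction)

-- Lists without repetition.

lookup-injective : ∀ {A : Set} {xs : List A} → Unique xs →
                   ∀ {i j} → lookup xs i ≡ lookup xs j → i ≡ j
lookup-injective (_    ∷ _)  {zero}  {zero}  _  = refl
lookup-injective (x∉xs ∷ _)  {zero}  {suc j} eq = contradiction eq (All.lookup x∉xs (∈-lookup j))
lookup-injective (x∉xs ∷ _)  {suc i} {zero}  eq = contradiction (sym eq) (All.lookup x∉xs (∈-lookup i))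
lookup-injective (_    ∷ xs) {suc i} {suc j} eq = cong suc (lookup-injective xs eq)

-- Looking up positions is injective from `Fin (length xs)` to `Fin n`, so the pigeonhole principle
-- applies.
unique⇒length≤ : ∀ {n} {xs : List (Fin n)} → Unique xs → length xs ≤ n
unique⇒length≤ xs! = injective⇒≤ (lookup-injective xs!)

Unique-∷ʳ : ∀ {A : Set} {xs : List A} {x} → Unique xs → x ∉ xs → Unique (xs ∷ʳ x)
Unique-∷ʳ xs! x∉xs = Unique.++⁺ xs! ([] ∷ []) λ { (v∈xs , here refl) → x∉xs v∈xs }

-- Logarithmic word size.

n≤2*⌈n/2⌉ : ∀ n → n ≤ 2 * ⌈ n /2⌉
n≤2*⌈n/2⌉ n = begin
  n                         ≡⟨ ⌊n/2⌋+⌈n/2⌉≡n n ⟨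
  ⌊ n /2⌋ + ⌈ n /2⌉         ≤⟨ +-mono-≤ (⌊n/2⌋≤⌈n/2⌉ n) (m≤m+n _ 0) ⟩
  2 * ⌈ n /2⌉               ∎
  where open ≤-Reasoning

n≤2^⌈log₂n⌉ : ∀ n → n ≤ 2 ^ ⌈log₂ n ⌉
n≤2^⌈log₂n⌉ = <-rec _ bound
  where
  open ≤-Reasoning

  bound : ∀ n → (∀ {m} → m < n → m ≤ 2 ^ ⌈log₂ m ⌉) → n ≤ 2 ^ ⌈log₂ n ⌉
  bound 0             _   = z≤n
  bound 1             _   = s≤s z≤n
  bound n@(suc (suc m)) rec = begin
    n                                  ≤⟨ n≤2*⌈n/2⌉ n ⟩
    2 * ⌈ n /2⌉                        ≤⟨ *-monoʳ-≤ 2 (rec (⌈n/2⌉<n m)) ⟩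
    2 * 2 ^ ⌈log₂ ⌈ n /2⌉ ⌉            ≡⟨ cong (λ l → 2 * 2 ^ l) (⌈log₂⌈n/2⌉⌉≡⌈log₂n⌉∸1 n) ⟩
    2 ^ ⌈log₂ n ⌉                      ∎

-- Every address and every size must fit into a word. Three times the logarithm suffices because the
-- expansion of the cube of `1 + n` contains `1 + n * 3`.
n*3<2^w : ∀ n w → 3 * ⌈log₂ suc n ⌉ ≤ w → n * 3 < 2 ^ w
n*3<2^w n w 3l≤w = begin-strict
  n * 3                                  <⟨ m≤m+n (suc (n * 3)) _ ⟩
  suc (n * 3) + (3 * (n * n) + n * n * n) ≡⟨ cube n ⟩
  suc n ^ 3                              ≤⟨ ^-monoˡ-≤ 3 (n≤2^⌈log₂n⌉ (suc n)) ⟩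
  (2 ^ l) ^ 3                            ≡⟨ ^-*-assoc 2 l 3 ⟩
  2 ^ (l * 3)                            ≡⟨ cong (2 ^_) (*-comm l 3) ⟩
  2 ^ (3 * l)                            ≤⟨ ^-monoʳ-≤ 2 3l≤w ⟩
  2 ^ w                                  ∎
  where
  open ≤-Reasoning
  l = ⌈log₂ suc n ⌉

  cube : ∀ n → 1 + n * 3 + (3 * (n * n) + n * n * n) ≡ (1 + n) * ((1 + n) * ((1 + n) * 1))
  cube = solve-∀

-- Out-degrees, and paths in a given spanning tree.

length-out≤maxOutDegree : ∀ {n} (G : Digraph n) v → length (out G v) ≤ maxOutDegree G
length-out≤maxOutDegree {n} G v =
  All.lookup (xs≤max 0 (map (λ v → length (out G v)) (allFin n))) (∈-map⁺ _ (∈-allFin v))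

∈⇒0<length : ∀ {A : Set} {x : A} {xs} → x ∈ xs → 0 < length xs
∈⇒0<length (here _)  = s≤s z≤n
∈⇒0<length (there _) = s≤s z≤n

-- Paths are walked backwards from their end point, where the in-degree condition applies.
rootPath : ∀ {n} {G : Digraph n} {r} {T} → IsDST G r T → ∀ v → Star (flip T) v r
rootPath {r = r} {T} dst v = extend ε (weaklyConnected r v)
  where
  open IsDST dst
  open IsOutBranching outBranching

  dropLast : ∀ {u v} → Star (flip T) v r → T u v → Star (flip T) u r
  dropLast ε          Tur = contradiction Tur (rootInDegree _)
  dropLast (Twv ◅ p) Tuv rewrite inDegree≤1 Tuv Twv = p

  extend : ∀ {u v} → Star (flip T) u r → EqClosure T u v → Star (flip T) v r
  extend p ε             = p
  extend p (fwd Tuv ◅ q) = extend (Tuv ◅ p) q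
  extend p (bwd Tvu ◅ q) = extend (dropLast p Tvu) q

-- Trees grown from the root, independent of the machine.

Edges : ℕ → Set
Edges n = List (Fin n × Fin n)

Member : ∀ {n} → Edges n → Rel (Fin n) 0ℓ
Member D u v = (u , v) ∈ D

target : ∀ {n} → Fin n × Fin n → Fin n
target (_ , v) = v

module Growth {n} (G : Digraph n) (r : Fin n) where

  vertices : Edges n → List (Fin n)
  vertices D = r ∷ map target D

  -- Edges are listed in order of discovery. The freshness condition `v ∉ vertices D` is the source
  -- of distinctness, of in-degree at most 1 and of acyclicity.
  data Grown : Edges n → Set where
    []   : Grown []
    grow : ∀ {D u v} → Grown D → u ∈ vertices D → v ∉ vertices D → Edge G u v →
           Grown (D ∷ʳ (u , v))

  vertices-++ : ∀ D D′ → vertices (D ++ D′) ≡ vertices D ++ map target D′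
  vertices-++ D D′ = cong (r ∷_) (map-++ target D D′)

  vertices-⊆ : ∀ D {D′ x} → x ∈ vertices D → x ∈ vertices (D ++ D′)
  vertices-⊆ D {D′} {x} x∈ = subst (x ∈_) (sym (vertices-++ D D′)) (∈-++⁺ˡ x∈)

  ∈-vertices-∷ʳ⁺ : ∀ D {u v} → v ∈ vertices (D ∷ʳ (u , v))
  ∈-vertices-∷ʳ⁺ D {v = v} =
    subst (v ∈_) (sym (vertices-++ D _)) (∈-++⁺ʳ (vertices D) (here refl))

  ∈-vertices-∷ʳ⁻ : ∀ D {u v x} → x ∈ vertices (D ∷ʳ (u , v)) → x ∈ vertices D ⊎ x ≡ v
  ∈-vertices-∷ʳ⁻ D {x = x} x∈
    with ∈-++⁻ (vertices D) (subst (x ∈_) (vertices-++ D _) x∈)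
  ... | inj₁ x∈D        = inj₁ x∈D
  ... | inj₂ (here x≡v) = inj₂ x≡v

  ∈-∷ʳ⁻ : ∀ (D : Edges n) {u v x y} → (x , y) ∈ D ∷ʳ (u , v) → (x , y) ∈ D ⊎ (x ≡ u × y ≡ v)
  ∈-∷ʳ⁻ D e∈ with ∈-++⁻ D e∈
  ... | inj₁ e∈D         = inj₁ e∈D
  ... | inj₂ (here refl) = inj₂ (refl , refl)

  target∈ : ∀ {D u v} → (u , v) ∈ D → v ∈ vertices D
  target∈ e∈D = there (∈-map⁺ target e∈D)

  source∈ : ∀ {D} → Grown D → ∀ {u v} → (u , v) ∈ D → u ∈ vertices D
  source∈ (grow {D} g u∈ _ _) e∈ with ∈-∷ʳ⁻ D e∈
  ... | inj₁ e∈D        = vertices-⊆ D (source∈ g e∈D)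
  ... | inj₂ (refl , _) = vertices-⊆ D u∈

  grown⇒edge : ∀ {D} → Grown D → ∀ {u v} → (u , v) ∈ D → Edge G u v
  grown⇒edge (grow {D} g _ _ e) e∈ with ∈-∷ʳ⁻ D e∈
  ... | inj₁ e∈D           = grown⇒edge g e∈D
  ... | inj₂ (refl , refl) = e

  grown⇒unique : ∀ {D} → Grown D → Unique (vertices D)
  grown⇒unique []                  = [] ∷ []
  grown⇒unique (grow {D} g _ v∉ _) =
    subst Unique (sym (vertices-++ D _)) (Unique-∷ʳ (grown⇒unique g) v∉)

  -- The root and the targets are pairwise distinct, one more vertex than there are edges.
  grown⇒length< : ∀ {D} → Grown D → length D < n
  grown⇒length< {D} g =
    subst (λ l → suc l ≤ n) (length-map target D) (unique⇒length≤ (grown⇒unique g))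

  grown⇒inDegree≤1 : ∀ {D} → Grown D → ∀ {u u′ v} → (u , v) ∈ D → (u′ , v) ∈ D → u ≡ u′
  grown⇒inDegree≤1 (grow {D} g _ v∉ _) e∈ e′∈ with ∈-∷ʳ⁻ D e∈ | ∈-∷ʳ⁻ D e′∈
  ... | inj₁ e∈D           | inj₁ e′∈D       = grown⇒inDegree≤1 g e∈D e′∈D
  ... | inj₁ e∈D           | inj₂ (_ , refl) = contradiction (target∈ e∈D) v∉
  ... | inj₂ (_ , refl)    | inj₁ e′∈D       = contradiction (target∈ e′∈D) v∉
  ... | inj₂ (refl , refl) | inj₂ (refl , _) = refl

  -- The depth in the tree strictly increases along edges, which excludes cycles. A new target is
  -- not an endpoint of any earlier edge, so giving it a depth leaves the earlier inequalities
  -- intact.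
  grown⇒rank : ∀ {D} → Grown D →
               Σ[ rank ∈ (Fin n → ℕ) ] (∀ {u v} → (u , v) ∈ D → rank u < rank v)
  grown⇒rank []                              = (λ _ → 0) , λ ()
  grown⇒rank (grow {D} {a} {b} g a∈ b∉ _) = rank′ , increasing
    where
    rank = proj₁ (grown⇒rank g)

    rank′ : Fin n → ℕ
    rank′ x with x ≟ b
    ... | yes _ = suc (rank a)
    ... | no  _ = rank x

    rank′-old : ∀ {x} → x ∈ vertices D → rank′ x ≡ rank x
    rank′-old {x} x∈ with x ≟ b
    ... | yes refl = contradiction x∈ b∉
    ... | no  _    = refl

    rank′-new : rank′ b ≡ suc (rank a)
    rank′-new with b ≟ b
    ... | yes _   = refl
    ... | no b≢b = contradiction refl b≢b

    increasing : ∀ {u v} → (u , v) ∈ D ∷ʳ (a , b) → rank′ u < rank′ v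
    increasing e∈ with ∈-∷ʳ⁻ D e∈
    ... | inj₁ e∈D
      rewrite rank′-old (source∈ g e∈D) | rank′-old (target∈ e∈D) = proj₂ (grown⇒rank g) e∈D
    ... | inj₂ (refl , refl) rewrite rank′-old a∈ | rank′-new = n<1+n (rank a)

  grown⇒acyclic : ∀ {D} → Grown D → ∀ v → ¬ TransClosure (Member D) v v
  grown⇒acyclic {D} g v p = <-irrefl refl (ascend p)
    where
    rank = proj₁ (grown⇒rank g)

    ascend : ∀ {x y} → TransClosure (Member D) x y → rank x < rank y
    ascend [ e ]   = proj₂ (grown⇒rank g) e
    ascend (e ∷ p) = <-trans (proj₂ (grown⇒rank g) e) (ascend p)

  grown⇒connected : ∀ {D} → Grown D → ∀ {v} → v ∈ vertices D → EqClosure (Member D) r v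
  grown⇒connected []                   (here refl) = ε
  grown⇒connected (grow {D} g u∈ _ _) v∈ with ∈-vertices-∷ʳ⁻ D v∈
  ... | inj₁ v∈D  = Eq.map ∈-++⁺ˡ (grown⇒connected g v∈D)
  ... | inj₂ refl =
    Eq.map ∈-++⁺ˡ (grown⇒connected g u∈) ◅◅ (fwd (∈-++⁺ʳ D (here refl)) ◅ ε)

  -- The tree `T` provides a path from `r` to each vertex; closedness carries membership along this
  -- path, so `D` reaches every vertex.
  grown⇒isDST : ∀ {D T} → IsDST G r T → Grown D →
                (∀ {x y} → x ∈ vertices D → Edge G x y → y ∈ vertices D) →
                IsDST G r (Member D)
  grown⇒isDST {D} dst g closed = record
    { outBranching = record
      { subgraph   = grown⇒edge g
      ; acyclic    = grown⇒acyclic g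
      ; inDegree≤1 = grown⇒inDegree≤1 g
      }
    ; weaklyConnected = λ u v →
        Eq.symmetric _ (grown⇒connected g (spanning u)) ◅◅ grown⇒connected g (spanning v)
    ; rootInDegree = λ u e∈D →
        Unique.Unique[x∷xs]⇒x∉xs (grown⇒unique g) (∈-map⁺ target e∈D)
    }
    where
    reached : ∀ {v} → Star (flip _) v r → v ∈ vertices D
    reached ε         = here refl
    reached (Tuv ◅ p) = closed (reached p) (IsOutBranching.subgraph (IsDST.outBranching dst) Tuv)

    spanning : ∀ v → v ∈ vertices D
    spanning v = reached (rootPath dst v)

-- The program and its memory layout.

-- Memory: visited marks in the cells 0, …, n − 1, and from cell n on the discovered edges, two
-- cells each.  Those in front of `front` have been emitted, those up to `back` are queued.
one front back tmp cur idx deg nbr : Fin 8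
one   = 0F
front = 1F
back  = 2F
tmp   = 3F
cur   = 4F
idx   = 5F
deg   = 6F
nbr   = 7F

program : Program 8
program =
  const one 1 ∷
  -- Both queue pointers start at cell n, just behind the marks.
  order front ∷
  order back ∷
  -- One mark for each of the n vertices and two cells for each of fewer than n edges fit into
  -- `n * 3` cells.
  const tmp 3 ∷
  binop mul tmp front tmp ∷
  allocLazy tmp tmp ∷
  root cur ∷
  store cur one ∷
  -- 8: visit cur
  const idx 0 ∷
  outDegree deg cur ∷
  -- 10: next neighbour of cur
  jumpIf≡ idx deg 21 ∷
  neighbour nbr cur idx ∷
  binop add idx idx one ∷
  load tmp nbr ∷
  jumpIf≡ tmp one 10 ∷
  store nbr one ∷
  store back cur ∷
  binop add back back one ∷
  store back nbr ∷
  binop add back back one ∷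
  jump 10 ∷
  -- 21: emit the next edge of the queue
  jumpIf≡ front back 28 ∷
  load tmp front ∷
  binop add front front one ∷
  load cur front ∷
  binop add front front one ∷
  emit tmp cur ∷
  jump 8 ∷
  -- 28:
  halt ∷ []

-- Memory updates and edge lists in memory.

if-yes : ∀ {A X : Set} (d : Dec A) {x y : X} → A → (if does d then x else y) ≡ x
if-yes (yes _) _ = refl
if-yes (no ¬a) a = contradiction a ¬a

if-no : ∀ {A X : Set} (d : Dec A) {x y : X} → ¬ A → (if does d then x else y) ≡ y
if-no (yes a) ¬a = contradiction a ¬a
if-no (no _)  _  = refl

update : (ℕ → ℕ) → ℕ → ℕ → ℕ → ℕ
update μ a x i = if does (i ℕ.≟ a) then x else μ i

update-same : ∀ μ a x → update μ a x a ≡ x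
update-same μ a x = if-yes (a ℕ.≟ a) refl

update-other : ∀ μ a x {i} → i ≢ a → update μ a x i ≡ μ i
update-other μ a x {i} = if-no (i ℕ.≟ a)

-- A list segment with both ends as indices: adjacent segments share a boundary address, so
-- dequeuing an edge moves the boundary and leaves memory alone.
data Stored {n} (μ : ℕ → ℕ) : ℕ → Edges n → ℕ → Set where
  []   : ∀ {h} → Stored μ h [] h
  cell : ∀ {h t u v Q} → μ h ≡ toℕ u → μ (suc h) ≡ toℕ v →
         Stored μ (2 + h) Q t → Stored μ h ((u , v) ∷ Q) t

stored-∷ʳ : ∀ {n μ h t} {Q : Edges n} {u v} → Stored μ h Q t →
            μ t ≡ toℕ u → μ (suc t) ≡ toℕ v → Stored μ h (Q ∷ʳ (u , v)) (2 + t)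
stored-∷ʳ []             μt μ1+t = cell μt μ1+t []
stored-∷ʳ (cell p q s) μt μ1+t = cell p q (stored-∷ʳ s μt μ1+t)

stored-end : ∀ {n μ h t} {Q : Edges n} → Stored μ h Q t → t ≡ h + length Q * 2
stored-end {h = h} [] = sym (+-identityʳ h)
stored-end {h = h} {Q = _ ∷ Q} (cell _ _ s) = trans (stored-end s) (shift h (length Q * 2))
  where
  shift : ∀ h l → 2 + h + l ≡ h + (2 + l)
  shift = solve-∀

-- A segment depends only on the cells between its ends, so it survives writes elsewhere.
stored-frame : ∀ {n μ μ′ h t} {Q : Edges n} → (∀ {i} → h ≤ i → i < t → μ′ i ≡ μ i) →
               Stored μ h Q t → Stored μ′ h Q t
stored-frame same []           = []
stored-frame {h = h} {t} same (cell {Q = Q} p q s) =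
  cell (trans (same ≤-refl (<-trans (n<1+n h) h+1<t)) p) (trans (same (n≤1+n h) h+1<t) q)
       (stored-frame (λ h+2≤i → same (≤-trans (m≤n+m h 2) h+2≤i)) s)
  where
  h+1<t : suc h < t
  h+1<t = subst (2 + h ≤_) (sym (stored-end s)) (m≤m+n (2 + h) (length Q * 2))

-- Execution of single instructions and access to the input.

module Simulation (w : ℕ) {n : ℕ} (G : Digraph n) (r : Fin n) (n*3<2^w : n * 3 < 2 ^ w) where

  open Growth G r
  open WordRAM w G r

  ≤n*3⇒fits : ∀ {x} → x ≤ n * 3 → x < 2 ^ w
  ≤n*3⇒fits x≤ = ≤-<-trans x≤ n*3<2^w

  ≤n⇒fits : ∀ {x} → x ≤ n → x < 2 ^ w
  ≤n⇒fits x≤n = ≤n*3⇒fits (≤-trans x≤n (m≤m*n n 3))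

  1≤n : 1 ≤ n
  1≤n = ≤-trans (s≤s z≤n) (toℕ<n r)

  vertex-allocated : ∀ (v : Fin n) → toℕ v < n * 3
  vertex-allocated v = <-≤-trans (toℕ<n v) (m≤m*n n 3)

  vertex-fits : ∀ (v : Fin n) → toℕ v < 2 ^ w
  vertex-fits v = ≤n*3⇒fits (<⇒≤ (vertex-allocated v))

  word-fits : ∀ {x} → x < 2 ^ w → word x ≡ x
  word-fits = m<n⇒m%n≡m {{m^n≢0 2 w}}

  _◆_ : ∀ {k} {P : Program k} {t t′ s s′ s″} →
        Silent P t s s′ → Silent P t′ s′ s″ → Silent P (t + t′) s s″
  done       ◆ q = q
  more e p ◆ q = more e (p ◆ q)

  -- Discards the reduction modulo `2 ^ w` for a value that fits, and lets the register content
  -- continue in the convenient form `y`.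
  assign : ∀ {k} {P : Program k} {pc ρ μ a z t s′} d x {y} →
           step P ⟨ pc , ρ , μ , a , z ⟩ ≡ silent ⟨ suc pc , ρ [ d ]≔ word x , μ , a , z ⟩ →
           x ≡ y → y < 2 ^ w →
           Silent P t ⟨ suc pc , ρ [ d ]≔ y , μ , a , z ⟩ s′ →
           Silent P (suc t) ⟨ pc , ρ , μ , a , z ⟩ s′
  assign {ρ = ρ} d x e refl x< p =
    more (trans e (cong (λ y → silent ⟨ _ , ρ [ d ]≔ y , _ , _ , _ ⟩) (word-fits x<))) p

  adjacency-toℕ : ∀ u → adjacency (toℕ u) ≡ map toℕ (out G u)
  adjacency-toℕ u with toℕ u <? n
  ... | yes u<n = cong (λ u → map toℕ (out G u)) (fromℕ<-toℕ u u<n)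
  ... | no  u≮n = contradiction (toℕ<n u) u≮n

  degree≡ : ∀ u → length (adjacency (toℕ u)) ≡ length (out G u)
  degree≡ u = trans (cong length (adjacency-toℕ u)) (length-map toℕ (out G u))

  degree≤n : ∀ u → length (out G u) ≤ n
  degree≤n u = unique⇒length≤ (out-unique G u)

  neighbourAt≡ : ∀ u ws {v vs} → out G u ≡ ws ++ v ∷ vs → neighbourAt (toℕ u) (length ws) ≡ toℕ v
  neighbourAt≡ u ws {v} {vs} eq =
    trans (cong (λ xs → fromMaybe 0 (head (drop (length ws) xs)))
                (trans (adjacency-toℕ u) (cong (map toℕ) eq)))
          (nth ws)
    where
    nth : ∀ ws → fromMaybe 0 (head (drop (length ws) (map toℕ (ws ++ v ∷ vs)))) ≡ toℕ v
    nth []       = refl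
    nth (_ ∷ ws) = nth ws

  -- The invariant relating memory to the search.

  record Invariant (E Q : Edges n) (h t : ℕ) (μ : ℕ → ℕ) : Set where
    field
      grown     : Grown (E ++ Q)
      visited   : ∀ {v} → v ∈ vertices (E ++ Q) → μ (toℕ v) ≡ 1
      unvisited : ∀ {v} → v ∉ vertices (E ++ Q) → μ (toℕ v) ≡ 0
      -- `E` holds the emitted edges and `Q` the queued ones; `h` and `t` are the contents of
      -- `front` and `back`.
      emitted   : Stored μ n E h
      queued    : Stored μ h Q t

    n≤h : n ≤ h
    n≤h = subst (n ≤_) (sym (stored-end emitted)) (m≤m+n n _)

    h≤t : h ≤ t
    h≤t = subst (h ≤_) (sym (stored-end queued)) (m≤m+n h _)

    n≤t : n ≤ t
    n≤t = ≤-trans n≤h h≤t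

    t≡ : t ≡ n + length (E ++ Q) * 2
    t≡ = begin
      t                                   ≡⟨ stored-end queued ⟩
      h + length Q * 2                    ≡⟨ cong (_+ length Q * 2) (stored-end emitted) ⟩
      n + length E * 2 + length Q * 2     ≡⟨ regroup n (length E) (length Q) ⟩
      n + (length E + length Q) * 2       ≡⟨ cong (λ l → n + l * 2) (length-++ E) ⟨
      n + length (E ++ Q) * 2             ∎
      where
      open ≡-Reasoning
      regroup : ∀ n a b → n + a * 2 + b * 2 ≡ n + (a + b) * 2
      regroup = solve-∀

    -- Since a grown tree has fewer than n edges, the queue never leaves the allocated block.
    t≤n*3 : t ≤ n * 3
    t≤n*3 = begin
      t                         ≡⟨ t≡ ⟩
      n + length (E ++ Q) * 2   ≤⟨ +-monoʳ-≤ n (*-monoˡ-≤ 2 (<⇒≤ (grown⇒length< grown))) ⟩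
      n + n * 2                 ≡⟨ three n ⟩
      n * 3                     ∎
      where
      open ≤-Reasoning
      three : ∀ n → n + n * 2 ≡ n * 3
      three = solve-∀

  open Invariant

  pushed : (ℕ → ℕ) → ℕ → Fin n → Fin n → ℕ → ℕ
  pushed μ t u v = update (update (update μ (toℕ v) 1) t (toℕ u)) (suc t) (toℕ v)

  -- The three writes do not interfere: the mark of `v` lies below n, whereas the two edge cells lie
  -- behind all marks and behind both stored segments.
  push : ∀ {E Q h t μ u v} → Invariant E Q h t μ →
         u ∈ vertices (E ++ Q) → v ∉ vertices (E ++ Q) → Edge G u v →
         Invariant E (Q ∷ʳ (u , v)) h (2 + t) (pushed μ t u v)
  push {E} {Q} {h} {t} {μ} {u} {v} I u∈ v∉ e = record
    { grown     = subst Grown assoc (grow (grown I) u∈ v∉ e)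
    ; visited   = marked
    ; unvisited = unmarked
    ; emitted   = stored-frame (λ n≤i i<h → queue-frame n≤i (<-≤-trans i<h (h≤t I))) (emitted I)
    ; queued    = stored-∷ʳ (stored-frame (λ h≤i → queue-frame (≤-trans (n≤h I) h≤i)) (queued I))
                            (trans (update-other μ₂ (suc t) (toℕ v) (<⇒≢ (n<1+n t)))
                                   (update-same μ₁ t (toℕ u)))
                            (update-same μ₂ (suc t) (toℕ v))
    }
    where
    μ₁ = update μ (toℕ v) 1
    μ₂ = update μ₁ t (toℕ u)

    assoc = ++-assoc E Q ((u , v) ∷ [])

    queue-frame : ∀ {i} → n ≤ i → i < t → pushed μ t u v i ≡ μ i
    queue-frame n≤i i<t =
      trans (update-other μ₂ (suc t) (toℕ v) (<⇒≢ (<-trans i<t (n<1+n t)))) $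
      trans (update-other μ₁ t (toℕ u) (<⇒≢ i<t)) $
      update-other μ (toℕ v) 1 (>⇒≢ (<-≤-trans (toℕ<n v) n≤i))

    mark-frame : ∀ x → pushed μ t u v (toℕ x) ≡ μ₁ (toℕ x)
    mark-frame x =
      trans (update-other μ₂ (suc t) (toℕ v) (<⇒≢ (<-trans x<t (n<1+n t))))
            (update-other μ₁ t (toℕ u) (<⇒≢ x<t))
      where x<t = <-≤-trans (toℕ<n x) (n≤t I)

    marked : ∀ {x} → x ∈ vertices (E ++ Q ∷ʳ (u , v)) → pushed μ t u v (toℕ x) ≡ 1
    marked {x} x∈ rewrite mark-frame x with x ≟ v
    ... | yes refl = update-same μ (toℕ v) 1
    ... | no x≢v with ∈-vertices-∷ʳ⁻ (E ++ Q) (subst (λ D → x ∈ vertices D) (sym assoc) x∈)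
    ...   | inj₁ x∈old = trans (update-other μ (toℕ v) 1 (x≢v ∘ toℕ-injective)) (visited I x∈old)
    ...   | inj₂ x≡v   = contradiction x≡v x≢v

    unmarked : ∀ {x} → x ∉ vertices (E ++ Q ∷ʳ (u , v)) → pushed μ t u v (toℕ x) ≡ 0
    unmarked {x} x∉ rewrite mark-frame x =
      trans (update-other μ (toℕ v) 1 (x≢v ∘ toℕ-injective))
            (unvisited I (x∉new ∘ vertices-⊆ (E ++ Q)))
      where
      x∉new : x ∉ vertices ((E ++ Q) ∷ʳ (u , v))
      x∉new = subst (λ D → x ∉ vertices D) (sym assoc) x∉

      x≢v : x ≢ v
      x≢v refl = x∉new (∈-vertices-∷ʳ⁺ (E ++ Q))

  pop : ∀ {E Q h t μ u v} → Invariant E ((u , v) ∷ Q) h t μ →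
        Invariant (E ∷ʳ (u , v)) Q (2 + h) t μ
  pop {E} {Q} {u = u} {v} I with queued I
  ... | cell p q s = record
    { grown     = subst Grown (sym assoc) (grown I)
    ; visited   = λ {x} x∈ → visited I (subst (λ D → x ∈ vertices D) assoc x∈)
    ; unvisited = λ {x} x∉ → unvisited I (x∉ ∘ subst (λ D → x ∈ vertices D) (sym assoc))
    ; emitted   = stored-∷ʳ (emitted I) p q
    ; queued    = s
    }
    where
    assoc : (E ∷ʳ (u , v)) ++ Q ≡ E ++ (u , v) ∷ Q
    assoc = ∷ʳ-++ E _ Q

  -- Scanning one adjacency list.

  at : (pc h t x : ℕ) → Fin n → (i d y : ℕ) → (ℕ → ℕ) → State 8
  at pc h t x u i d y μ =
    -- The register `one` keeps the value 1, and both counters stay at `n * 3` after the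
    -- initialization.
    ⟨ pc , 1 ∷ h ∷ t ∷ x ∷ toℕ u ∷ i ∷ d ∷ y ∷ [] , μ , n * 3 , n * 3 ⟩

  record Scan (E Q : Edges n) (h t x : ℕ) (u : Fin n) (i y : ℕ) (μ : ℕ → ℕ)
              (vs : List (Fin n)) : Set where
    field
      {Q′}          : Edges n
      {t′ x′ i′ y′} : ℕ
      {μ′}          : ℕ → ℕ
      {steps}       : ℕ
      run           : Silent program steps (at 10 h t x u i (length (out G u)) y μ)
                             (at 21 h t′ x′ u i′ (length (out G u)) y′ μ′)
      -- A new neighbour costs 4 instructions to fetch and 7 to enqueue, a known one only 5 in all;
      -- 1 more leaves the loop.
      steps≤        : steps ≤ 1 + length vs * 11
      invariant     : Invariant E Q′ h t′ μ′
      extends       : ∀ {x} → x ∈ vertices (E ++ Q) → x ∈ vertices (E ++ Q′)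
      scanned       : ∀ {x} → x ∈ vs → x ∈ vertices (E ++ Q′)

  -- The common part of both kinds of loop iteration, up to the test of the mark `m`.
  fetch : ∀ {h t x u y μ ws v vs m steps s} →
          out G u ≡ ws ++ v ∷ vs → μ (toℕ v) ≡ m → m < 2 ^ w →
          Silent program steps
                 (at 14 h t m u (length (ws ∷ʳ v)) (length (out G u)) (toℕ v) μ) s →
          Silent program (4 + steps) (at 10 h t x u (length ws) (length (out G u)) y μ) s
  fetch {u = u} {μ = μ} {ws} {v} {vs} eq μv m< p =
    more (if-no (length ws ℕ.≟ length (out G u)) (<⇒≢ (<-≤-trans (m<m+n _ z<s) ws+1≤)))  $
    assign nbr (neighbourAt (toℕ u) (length ws)) refl (neighbourAt≡ u ws eq) (vertex-fits v) $
    assign idx (length ws + 1) refl (sym (length-++ ws)) (≤n⇒fits ws∷ʳv≤) $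
    assign tmp (μ (toℕ v)) (if-yes (toℕ v <? n * 3) (vertex-allocated v)) μv m< p
    where
    ws+1≤ : length ws + 1 ≤ length (out G u)
    ws+1≤ = subst (length ws + 1 ≤_) (sym (trans (cong length eq) (length-++ ws)))
                  (+-monoʳ-≤ (length ws) (s≤s z≤n))

    ws∷ʳv≤ : length (ws ∷ʳ v) ≤ n
    ws∷ʳv≤ = subst (_≤ n) (sym (length-++ ws)) (≤-trans ws+1≤ (degree≤n u))

  discover : ∀ {h t u i d v μ} → 2 + t ≤ n * 3 →
             Silent program 7 (at 14 h t 0 u i d (toℕ v) μ)
                              (at 10 h (2 + t) 0 u i d (toℕ v) (pushed μ t u v))
  discover {t = t} {v = v} 2+t≤ =
    more refl $
    more (if-yes (toℕ v <? n * 3) (vertex-allocated v)) $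
    more (if-yes (t <? n * 3) (<-trans (n<1+n t) 2+t≤)) $
    assign back (t + 1) refl (+-comm t 1) (≤n*3⇒fits (<⇒≤ 2+t≤)) $
    more (if-yes (suc t <? n * 3) 2+t≤) $
    assign back (suc t + 1) refl (+-comm (suc t) 1) (≤n*3⇒fits 2+t≤) $
    more refl done

  -- Induction on the unscanned suffix `vs`, behind the scanned prefix `ws`. By the invariant,
  -- deciding membership among the discovered vertices predicts the branch that the machine takes at
  -- the mark.
  scan : ∀ {E Q h t u μ x y} ws vs → out G u ≡ ws ++ vs → u ∈ vertices (E ++ Q) →
         Invariant E Q h t μ → Scan E Q h t x u (length ws) y μ vs
  scan {u = u} ws [] eq u∈ I = record
    { run       = more (if-yes (length ws ℕ.≟ length (out G u)) exhausted) done
    ; steps≤    = s≤s z≤n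
    ; invariant = I
    ; extends   = λ x∈ → x∈
    ; scanned   = λ ()
    }
    where
    exhausted : length ws ≡ length (out G u)
    exhausted = cong length (sym (trans eq (++-identityʳ ws)))
  scan {E} {Q} {h} {t} {u} {μ} {x} {y} ws (v ∷ vs) eq u∈ I with _∈?_ _≟_ v (vertices (E ++ Q))
  ... | yes v∈ = record
    { run       = fetch {ws = ws} eq (visited I v∈) (≤n⇒fits 1≤n) (more refl run)
    ; steps≤    = ≤-trans (+-monoʳ-≤ 5 steps≤) (+-monoˡ-≤ _ (m≤m+n 6 6))
    ; invariant = invariant
    ; extends   = extends
    ; scanned   = λ { (here refl) → extends v∈ ; (there x∈) → scanned x∈ }
    }
    where open Scan (scan {x = 1} {toℕ v} (ws ∷ʳ v) vs (trans eq (sym (∷ʳ-++ ws v vs))) u∈ I)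
  ... | no v∉ = record
    -- Room for the two new cells follows from the invariant after the insertion, since the enlarged
    -- tree still has fewer than n edges.
    { run       = fetch {ws = ws} eq (unvisited I v∉) (≤n⇒fits z≤n) (discover (t≤n*3 I′) ◆ run)
    ; steps≤    = +-monoʳ-≤ 11 steps≤
    ; invariant = invariant
    ; extends   = extends ∘ grows
    ; scanned   = λ { (here refl) → extends v∈′ ; (there x∈) → scanned x∈ }
    }
    where
    edge : Edge G u v
    edge = subst (v ∈_) (sym eq) (∈-++⁺ʳ ws (here refl))

    I′ = push I u∈ v∉ edge

    assoc = ++-assoc E Q ((u , v) ∷ [])

    grows : ∀ {x} → x ∈ vertices (E ++ Q) → x ∈ vertices (E ++ Q ∷ʳ (u , v))
    grows {x} x∈ = subst (λ D → x ∈ vertices D) assoc (vertices-⊆ (E ++ Q) x∈)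

    v∈′ : v ∈ vertices (E ++ Q ∷ʳ (u , v))
    v∈′ = subst (λ D → v ∈ vertices D) assoc (∈-vertices-∷ʳ⁺ (E ++ Q))

    open Scan (scan {x = 0} {toℕ v} (ws ∷ʳ v) vs (trans eq (sym (∷ʳ-++ ws v vs))) (grows u∈) I′)

  -- The main loop and its delay.

  Δ = maxOutDegree G

  record Search (E : Edges n) (s : State 8) : Set where
    field
      {rest}     : Edges n
      {final}    : State 8
      -- Halting is allowed `28 * suc Δ` because `Δ` may be 0 when there is no edge to emit.
      run        : Run program (28 * Δ) (28 * suc Δ) s rest final
      grown      : Grown (E ++ rest)
      closed     : ∀ {x y} → x ∈ vertices (E ++ rest) → Edge G x y → y ∈ vertices (E ++ rest)
      allocated≡ : allocated final ≡ n * 3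
      lazyCells≡ : lazyCells final ≡ n * 3

  -- The dequeued vertices are `r` and the targets of `E`; only the current one, `u`, may still have
  -- undiscovered out-neighbours.
  Closed : Edges n → Edges n → Fin n → Set
  Closed E Q u = ∀ {x} → x ∈ vertices E → x ≡ u ⊎ (∀ {y} → Edge G x y → y ∈ vertices (E ++ Q))

  -- Each round emits one edge, and a grown tree has fewer than n of them, so the fuel cannot run
  -- out. `s` is the state from which the current delay is counted, and `t₀` the time since then: 8
  -- for the initialization, or 1 for the jump after an emission.
  search : ∀ fuel {E Q u h t μ x i d y s t₀} → length E + fuel ≡ n →
           Silent program t₀ s (at 8 h t x u i d y μ) → t₀ ≤ 8 →
           Invariant E Q h t μ → u ∈ vertices E → Closed E Q u → Search E s
  search zero {E} {Q} E≡n _ _ I _ _ =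
    contradiction (grown⇒length< (grown I)) (≤⇒≯ n≤length)
    where
    open ≤-Reasoning
    n≤length : n ≤ length (E ++ Q)
    n≤length = begin
      n                     ≡⟨ E≡n ⟨
      length E + 0          ≤⟨ +-monoʳ-≤ (length E) z≤n ⟩
      length E + length Q   ≡⟨ length-++ E ⟨
      length (E ++ Q)       ∎
  search (suc fuel) {E} {Q} {u} {h} {t} {x = x} {s = s} {t₀ = t₀} E+f≡n start t₀≤8 I u∈ old =
    proceed round round≤ S.invariant closed-E
    where
    S : Scan E Q h t x u 0 _ _ (out G u)
    S = scan [] (out G u) refl (vertices-⊆ E u∈) I

    module S = Scan S

    round : Silent program (t₀ + (2 + S.steps)) s
                   (at 21 h S.t′ S.x′ u S.i′ (length (out G u)) S.y′ S.μ′)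
    round = start ◆
      (assign idx 0 refl refl (≤n⇒fits z≤n) $
       assign deg (length (adjacency (toℕ u))) refl (degree≡ u) (≤n⇒fits (degree≤n u)) S.run)

    closed-E : ∀ {x y} → x ∈ vertices E → Edge G x y → y ∈ vertices (E ++ S.Q′)
    closed-E x∈ e with old x∈
    ... | inj₁ refl   = S.scanned e
    ... | inj₂ closed = S.extends (closed e)

    round≤ : t₀ + (2 + S.steps) ≤ 11 + 11 * Δ
    round≤ = begin
      -- Here 11 is 8 steps before the visit, 2 to set up the scan and 1 to leave its loop.
      t₀ + (2 + S.steps)                   ≤⟨ +-mono-≤ t₀≤8 (+-monoʳ-≤ 2 S.steps≤) ⟩
      11 + length (out G u) * 11           ≤⟨ +-monoʳ-≤ 11 (*-monoˡ-≤ 11 (length-out≤maxOutDegree G u)) ⟩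
      11 + Δ * 11                          ≡⟨ cong (11 +_) (*-comm Δ 11) ⟩
      11 + 11 * Δ                          ∎
      where open ≤-Reasoning

    -- Generalizing over the result of the scan allows a case split on the queue.
    proceed : ∀ {steps Q′ t′ x′ i′ d y′ μ′} →
              Silent program steps s (at 21 h t′ x′ u i′ d y′ μ′) → steps ≤ 11 + 11 * Δ →
              Invariant E Q′ h t′ μ′ →
              (∀ {x y} → x ∈ vertices E → Edge G x y → y ∈ vertices (E ++ Q′)) →
              Search E s
    proceed {steps} {[]} {t′} p steps≤ I′ closed = record
      { run        = stop (p ◆ more (if-yes (h ℕ.≟ t′) empty) done) refl halts
      ; grown      = grown I′
      ; closed     = closed ∘ subst (λ D → _ ∈ vertices D) (++-identityʳ E)
      ; allocated≡ = refl
      ; lazyCells≡ = refl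
      }
      where
      empty : h ≡ t′
      empty = sym (trans (stored-end (queued I′)) (+-identityʳ h))

      halts : suc (steps + 1) ≤ 28 * suc Δ
      halts = begin
        suc (steps + 1)         ≤⟨ s≤s (+-monoˡ-≤ 1 steps≤) ⟩
        suc (11 + 11 * Δ + 1)   ≤⟨ m≤m+n _ (15 + 17 * Δ) ⟩
        suc (11 + 11 * Δ + 1) + (15 + 17 * Δ) ≡⟨ total Δ ⟩
        28 * suc Δ              ∎
        where
        open ≤-Reasoning
        total : ∀ d → 1 + (11 + 11 * d + 1) + (15 + 17 * d) ≡ 28 * (1 + d)
        total = solve-∀
    proceed {steps} {(p , v) ∷ Q″} {t′} {i′ = i′} {d} {y′} {μ′} pre steps≤ I′ closed with queued I′
    ... | cell μh≡p μ1+h≡v q = record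
      { run        = next
          (pre ◆
            (more (if-no (h ℕ.≟ t′) (<⇒≢ (<-trans (n<1+n h) h+1<t′))) $
             assign tmp (μ′ h) (if-yes (h <? n * 3) (<-trans (n<1+n h) h+1<n*3))
                    μh≡p (vertex-fits p) $
             assign front (h + 1) refl (+-comm h 1) (≤n*3⇒fits (<⇒≤ h+1<n*3)) $
             assign cur (μ′ (suc h)) (if-yes (suc h <? n * 3) h+1<n*3)
                    μ1+h≡v (vertex-fits v) $
             assign front (suc h + 1) refl (+-comm (suc h) 1) (≤n*3⇒fits h+1<n*3) done))
          refl delay R.run
      ; grown      = subst Grown assoc R.grown
      ; closed     = λ {x} {y} x∈ e →
          subst (λ D → y ∈ vertices D) assoc
                (R.closed (subst (λ D → x ∈ vertices D) (sym assoc) x∈) e)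
      ; allocated≡ = R.allocated≡
      ; lazyCells≡ = R.lazyCells≡
      }
      where
      h+1<t′ : suc h < t′
      h+1<t′ = subst (2 + h ≤_) (sym (stored-end q)) (m≤m+n (2 + h) _)

      h+1<n*3 : suc h < n * 3
      h+1<n*3 = <-≤-trans h+1<t′ (t≤n*3 I′)

      E′ = E ∷ʳ (p , v)

      1≤Δ : 1 ≤ Δ
      1≤Δ = ≤-trans (∈⇒0<length (grown⇒edge (grown I′) (∈-++⁺ʳ E (here refl))))
                    (length-out≤maxOutDegree G p)

      delay : suc (steps + 5) ≤ 28 * Δ
      -- Besides 11 per neighbour, at most 17 instructions are spent: 11 from the round, 5 to
      -- dequeue and 1 to emit. As `1 ≤ Δ`, they are absorbed into `17 * Δ`, which gives the
      -- constant 28.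
      delay = begin
        suc (steps + 5)        ≤⟨ s≤s (+-monoˡ-≤ 5 steps≤) ⟩
        suc (11 + 11 * Δ + 5)  ≡⟨ regroup Δ ⟩
        17 * 1 + 11 * Δ        ≤⟨ +-monoˡ-≤ (11 * Δ) (*-monoʳ-≤ 17 1≤Δ) ⟩
        17 * Δ + 11 * Δ        ≡⟨ *-distribʳ-+ Δ 17 11 ⟨
        28 * Δ                 ∎
        where
        open ≤-Reasoning
        regroup : ∀ d → 1 + (11 + 11 * d + 5) ≡ 17 * 1 + 11 * d
        regroup = solve-∀

      E′+f≡n : length E′ + fuel ≡ n
      E′+f≡n = begin
        length E′ + fuel        ≡⟨ cong (_+ fuel) (length-++ E) ⟩
        length E + 1 + fuel     ≡⟨ +-assoc (length E) 1 fuel ⟩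
        length E + suc fuel     ≡⟨ E+f≡n ⟩
        n                       ∎
        where open ≡-Reasoning

      old′ : Closed E′ Q″ v
      old′ x∈ with ∈-vertices-∷ʳ⁻ E x∈
      ... | inj₁ x∈E = inj₂ λ {y} e →
              subst (λ D → y ∈ vertices D) (sym (∷ʳ-++ E _ Q″)) (closed x∈E e)
      ... | inj₂ x≡v = inj₁ x≡v

      module R = Search
        (search fuel {s = at 27 (2 + h) t′ (toℕ p) v i′ d y′ μ′} E′+f≡n
                (more refl done) (s≤s z≤n) (pop I′) (∈-vertices-∷ʳ⁺ E) old′)

      assoc : E′ ++ R.rest ≡ E ++ (p , v) ∷ R.rest
      assoc = ∷ʳ-++ E _ R.rest

  -- Initialization.

  blank prepared : (ℕ → ℕ) → ℕ → ℕ
  -- The only block has base address 0, so vertex numbers are directly the addresses of their marks.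
  blank garbage i  = if does (0 ≤? i) ∧ does (i <? n * 3) then 0 else garbage i
  prepared garbage = update (blank garbage) (toℕ r) 1

  prepared-invariant : ∀ garbage → Invariant [] [] n n (prepared garbage)
  prepared-invariant garbage = record
    { grown     = []
    ; visited   = λ { (here refl) → update-same (blank garbage) (toℕ r) 1 }
    ; unvisited = λ {v} v∉ →
        trans (update-other (blank garbage) (toℕ r) 1 (λ v≡r → v∉ (here (toℕ-injective v≡r))))
              (if-yes (toℕ v <? n * 3) {0} {garbage (toℕ v)} (vertex-allocated v))
    ; emitted   = []
    ; queued    = []
    }

  prepare : ∀ garbage → Silent program 8 (initial garbage) (at 8 n n 0 r 0 0 0 (prepared garbage))
  prepare garbage =
    assign one 1 refl refl (≤n⇒fits 1≤n) $
    assign front n refl refl (≤n⇒fits ≤-refl) $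
    assign back n refl refl (≤n⇒fits ≤-refl) $
    assign tmp 3 refl refl (≤n*3⇒fits (*-monoˡ-≤ 3 1≤n)) $
    assign tmp (n * 3) refl refl n*3<2^w $
    more (trans (if-yes (n * 3 ≤? 2 ^ w) (<⇒≤ n*3<2^w))
                (cong (λ base → silent ⟨ 6 , 1 ∷ n ∷ n ∷ base ∷ 0 ∷ 0 ∷ 0 ∷ 0 ∷ []
                                       , blank garbage , n * 3 , n * 3 ⟩)
                      (word-fits (≤n⇒fits z≤n)))) $
    assign cur (toℕ r) refl refl (vertex-fits r) $
    more (if-yes (toℕ r <? n * 3) (vertex-allocated r)) $
    done

  searchAll : ∀ garbage → Search [] (initial garbage)
  searchAll garbage =
    search n refl (prepare garbage) ≤-refl (prepared-invariant garbage) (here refl)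
      -- Initially the root is the only discovered vertex, and it is the one about to be scanned.
      λ { (here refl) → inj₁ refl }

corollary12 : ∃[ k ] Σ[ P ∈ Program k ] ∃[ κ ] ∃[ c ]
    (∀ {n} (G : Digraph n) (r : Fin n) →
    (Σ[ T ∈ Rel (Fin n) 0ℓ ] IsDST G r T) →
    ∀ w → κ * ⌈log₂ suc n ⌉ ≤ w →
    ∀ (garbage : ℕ → ℕ) →
    Σ[ T ∈ Rel (Fin n) 0ℓ ] Σ[ L ∈ List (Fin n × Fin n) ] Σ[ s ∈ State k ]
    (IsDST G r T
    × ListsOnce L T
    × WordRAM.Run w G r P (c * maxOutDegree G) (c * suc (maxOutDegree G)) (initial garbage) L s
    × Within c (lazyCells s) n
    × Within c (space s) n))
-- The witnesses are 8 registers, the word-size factor 3 that makes `n * 3` fit, and the delay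
-- constant 28, which is also ample for both memory bounds.
corollary12 = 8 , program , 3 , 28 , λ {n} G r (_ , dst) w 3l≤w garbage →
  let open Simulation w G r (n*3<2^w n w 3l≤w)
      open Growth G r
      open Search (searchAll garbage)
  in Member rest , rest , final
   , grown⇒isDST dst grown closed
   -- Distinct targets make the edges distinct; the tree is defined as membership in the emitted
   -- list, so the equivalence is the identity.
   , (Unique.map⁻ (AllPairs.tail (grown⇒unique grown)) , λ _ _ → ⇔-id _)
   , run
   , subst (λ z → Within 28 z n) (sym lazyCells≡) (within-n*3 n)
   , subst (λ a → Within 28 (8 + a) n) (sym allocated≡) (within-8+n*3 n 1≤n)
  where
  within-n*3 : ∀ n → Within 28 (n * 3) n
  within-n*3 n = ≤-trans (m≤m*n n 3) (m≤n*m (n * 3) 28)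
               , subst (_≤ 28 * n) (*-comm 3 n) (*-monoˡ-≤ n (m≤m+n 3 25))

  within-8+n*3 : ∀ n → 1 ≤ n → Within 28 (8 + n * 3) n
  within-8+n*3 n 1≤n = ≤-trans (≤-trans (m≤m*n n 3) (m≤n+m (n * 3) 8)) (m≤n*m (8 + n * 3) 28)
                     , bound
    where
    open ≤-Reasoning
    bound : 8 + n * 3 ≤ 28 * n
    bound = begin
      -- The 8 registers count as space; they are linear in n because the root witnesses `1 ≤ n`.
      8 * 1 + n * 3   ≤⟨ +-mono-≤ (*-monoʳ-≤ 8 1≤n) (≤-reflexive (*-comm n 3)) ⟩
      8 * n + 3 * n   ≡⟨ *-distribʳ-+ n 8 3 ⟨
      11 * n          ≤⟨ *-monoˡ-≤ n (m≤m+n 11 17) ⟩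
      28 * n          ∎
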